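{- Let $\mathcal{P}$ be an $(\alpha,\beta)$-rigid linkage of order $t$ in a graph $G$, and let $A\in\mathcal{S}(G)$. Then $\operatorname{null}(A(V(\mathcal{P})))\ge\operatorname{null}(A)-t$.
   Context: $G$ is a simple graph on vertex set $\{1,\dots,n\}$. $\mathcal{S}(G)$ is the set of real symmetric $n\times n$ matrices $A=[a_{ij}]$ with $a_{ij}\ne0$ if $ij\in E(G)$ and $a_{ij}=0$ if $i\ne j$ and $ij\notin E(G)$ (diagonal unrestricted). For $\gamma\subseteq\{1,\dots,n\}$, $A(\gamma)$ is the principal submatrix obtained by deleting rows and columns indexed by $\gamma$. A linkage in $G$ is a subgraph whose components are paths (a single vertex counts as a path); its order is the number of paths; $V(\mathcal{P})$ is its vertex set. For $\alpha,\beta\subseteq V(G)$, $\mathcal{P}$ is an $(\alpha,\beta)$-linkage if $\alpha$ consists of one endpoint of each path and $\beta$ of the other endpoints (a one-vertex path has its vertex in both), and it is $(\alpha,\beta)$-rigid if it is the unique $(\alpha,\beta)$-linkage in $G$. -}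

module Defs where

open import Level using (0ℓ)
open import Data.Nat using (ℕ; zero; suc)
open import Data.Fin using (Fin; zero; suc)
open import Data.Bool using (Bool; true; false)
open import Data.Product using (Σ; ∃; _×_; _,_)
open import Data.Unit using (⊤)
open import Data.Empty using (⊥)
open import Data.Maybe using (Maybe; just; nothing)
open import Data.List using (List; []; _∷_; concat; length; head; last)
open import Data.List.Relation.Unary.All using (All)
open import Data.List.Relation.Unary.Any using (Any)
open import Data.List.Relation.Unary.Unique.Propositional using (Unique)
open import Data.List.Membership.Propositional using (_∈_)
open import Relation.Nullary using (¬_)
open import Relation.Binary.PropositionalEquality using (_≡_; _≢_)
open import Relation.Binary.Structures using (IsTotalOrder)
open import Algebra.Structures using (IsCommutativeRing)
open import Function.Bundles using (_⇔_)

-- The real numbers, axiomatised as a Dedekind-complete ordered field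
-- (unique up to isomorphism), with propositional equality.

record RealField : Set₁ where
  infixl 6 _+_
  infixl 7 _*_
  field
    ℝ     : Set
    _+_   : ℝ → ℝ → ℝ
    _*_   : ℝ → ℝ → ℝ
    -_    : ℝ → ℝ
    0#    : ℝ
    1#    : ℝ
    isCommutativeRing : IsCommutativeRing _≡_ _+_ _*_ -_ 0# 1#
    0≢1   : 0# ≢ 1#
    inverse : ∀ x → x ≢ 0# → Σ ℝ (λ y → x * y ≡ 1#)
    _≤_   : ℝ → ℝ → Set
    isTotalOrder : IsTotalOrder _≡_ _≤_
    +-mono-≤ : ∀ {x y} z → x ≤ y → (x + z) ≤ (y + z)
    *-nonneg : ∀ {x y} → 0# ≤ x → 0# ≤ y → 0# ≤ (x * y)
    complete : (P : ℝ → Set) → Σ ℝ P → Σ ℝ (λ b → ∀ x → P x → x ≤ b) →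
               Σ ℝ (λ s → (∀ x → P x → x ≤ s) ×
                          (∀ b → (∀ x → P x → x ≤ b) → s ≤ b))

record Graph (n : ℕ) : Set where
  field
    adj   : Fin n → Fin n → Bool
    sym   : ∀ i j → adj i j ≡ adj j i
    irrefl : ∀ i → adj i i ≡ false

open Graph public

module LinAlg (R : RealField) where
  open RealField R

  Matrix : ℕ → Set
  Matrix n = Fin n → Fin n → ℝ

  Vector : ℕ → Set
  Vector n = Fin n → ℝ

  ∑ : ∀ {m} → (Fin m → ℝ) → ℝ
  ∑ {zero}  f = 0#
  ∑ {suc m} f = f zero + ∑ (λ i → f (suc i))

  InS : ∀ {n} → Graph n → Matrix n → Set
  InS {n} G A =
    (∀ i j → A i j ≡ A j i) ×
    (∀ i j → i ≢ j → (adj G i j ≡ true → A i j ≢ 0#) ×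
                     (adj G i j ≡ false → A i j ≡ 0#))

  VSet : ℕ → Set₁
  VSet n = Fin n → Set

  -- Null vectors of the principal submatrix A(γ) (rows/columns indexed by
  -- γ deleted), represented by their extension by zero to Fin n:
  -- x vanishes on γ and (A x)_i = 0 for every i ∉ γ.
  NullVecSub : ∀ {n} → Matrix n → VSet n → Vector n → Set
  NullVecSub {n} A γ x =
    (∀ i → γ i → x i ≡ 0#) × (∀ i → ¬ γ i → ∑ (λ j → A i j * x j) ≡ 0#)

  NullVec : ∀ {n} → Matrix n → Vector n → Set
  NullVec A x = ∀ i → ∑ (λ j → A i j * x j) ≡ 0#

  LinIndep : ∀ {k n} → (Fin k → Vector n) → Set
  LinIndep {k} v = ∀ (c : Fin k → ℝ) → (∀ j → ∑ (λ i → c i * v i j) ≡ 0#) →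
                   ∀ i → c i ≡ 0#

  NullityAtLeast : ∀ {n} → Matrix n → ℕ → Set
  NullityAtLeast {n} A k =
    Σ (Fin k → Vector n) (λ v → (∀ i → NullVec A (v i)) × LinIndep v)

  SubNullityAtLeast : ∀ {n} → Matrix n → VSet n → ℕ → Set
  SubNullityAtLeast {n} A γ k =
    Σ (Fin k → Vector n) (λ v → (∀ i → NullVecSub A γ (v i)) × LinIndep v)

-- Linkages.  A linkage is represented by the list of its paths, each path
-- a nonempty list of vertices (consecutive ones adjacent), all vertices of
-- all paths distinct.  Each path is listed from its α-endpoint to its
-- β-endpoint.  The linkage as a subgraph has vertex set the union of the
-- paths and edge set the consecutive pairs.

module _ {n : ℕ} (G : Graph n) where

  IsPath : List (Fin n) → Set
  IsPath []           = ⊥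
  IsPath (x ∷ [])     = ⊤
  IsPath (x ∷ y ∷ xs) = (adj G x y ≡ true) × IsPath (y ∷ xs)

  IsLinkage : List (List (Fin n)) → Set
  IsLinkage ps = All IsPath ps × Unique (concat ps)

order : ∀ {n} → List (List (Fin n)) → ℕ
order = length

VOf : ∀ {n} → List (List (Fin n)) → Fin n → Set
VOf ps v = v ∈ concat ps

Consec : ∀ {n} → Fin n → Fin n → List (Fin n) → Set
Consec u v []           = ⊥
Consec u v (x ∷ [])     = ⊥
Consec u v (x ∷ y ∷ xs) = ((u ≡ x) × (v ≡ y)) Data.Sum.⊎ Consec u v (y ∷ xs)
  where import Data.Sum

EdgeOf : ∀ {n} → List (List (Fin n)) → Fin n → Fin n → Set
EdgeOf ps u v = Any (λ p → Consec u v p Data.Sum.⊎ Consec v u p) ps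
  where import Data.Sum

module _ {n : ℕ} (G : Graph n) where

  IsαβLinkage : (Fin n → Set) → (Fin n → Set) → List (List (Fin n)) → Set
  IsαβLinkage α β ps =
    IsLinkage G ps ×
    (∀ v → (α v ⇔ Any (λ p → head p ≡ just v) ps)) ×
    (∀ v → (β v ⇔ Any (λ p → last p ≡ just v) ps))

  IsRigid : (Fin n → Set) → (Fin n → Set) → List (List (Fin n)) → Set
  IsRigid α β ps =
    IsαβLinkage α β ps ×
    (∀ qs → IsαβLinkage α β qs →
       (∀ v → (VOf qs v ⇔ VOf ps v)) × (∀ u v → (EdgeOf qs u v ⇔ EdgeOf ps u v)))

{-# OPTIONS --safe #-}

-- Let V = V(P), and let F be a set of null(A(V)) coordinates outside V on which a null vector
-- of A(V) is determined. It suffices that a null vector x of A that vanishes on α and on F is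
-- zero, because then null(A) ≤ t + null(A(V)).
--
-- If such an x vanishes on V, it is a null vector of A(V) and hence zero. Otherwise call a path
-- stuck if x is not zero on it, and let c be the vertex before the first vertex s of the path
-- with x_s ≠ 0. Row c of A x = 0 gives a neighbour w ≠ s of c with x_w ≠ 0. The part of x
-- on the vertices outside V from which G − V does not lead to V ∩ supp x is a null vector of
-- A(V) vanishing on F, so it is zero: thus w is joined, through G − V or trivially, to a vertex
-- τ of V with x_τ ≠ 0, which lies beyond the vertex c of a stuck path. This defines a map f from
-- stuck paths to stuck paths. On a set of paths permuted by f, following each path up to c, then
-- going to τ, then continuing along the path of τ gives another (α,β)-linkage: it uses the edge
-- cw, which P does not. This contradicts rigidity.

module Submission where

open import Defs hiding (sym)
open import Level using (0ℓ)
open import Algebra.Bundles using (CommutativeRing)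
import Algebra.Properties.Ring as RingProperties
import Algebra.Properties.Semiring.Sum as Sums
open import Data.Nat as ℕ using (ℕ; zero; suc; _∸_)
import Data.Nat.Properties as ℕ
open import Data.Bool using (true; false)
import Data.Bool.Properties as Bool
open import Data.Fin as Fin using (Fin; zero; suc; punchIn; punchOut; splitAt; inject≤; _↑ˡ_; _↑ʳ_)
open import Data.Fin.Properties as Fin
  using (any?; injective⇒≤; punchOut-injective; punchInᵢ≢i; punchIn-injective; punchIn-punchOut;
         splitAt-↑ˡ; splitAt-↑ʳ; inject≤-injective)
open import Data.Fin.Subset using (Subset; _-_; Nonempty) renaming (_∈_ to _∈ₛ_; ⊤ to full)
open import Data.Fin.Subset.Properties using (∈⊤; p─q⊆p; x∈p⇒p-x⊂p; x∈p∧x≢y⇒x∈p-y)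
  renaming (_∈?_ to _∈ₛ?_)
open import Data.Fin.Subset.Induction using (⊂-wellFounded)
open import Data.List using (List; []; _∷_; _++_; concat; lookup; head; last; length; tabulate)
open import Data.List.Properties using (++-assoc; ++-identityʳ)
open import Data.List.Membership.DecPropositional using (_∈?_)
open import Data.List.Membership.Propositional using (_∈_; lose)
open import Data.List.Membership.Propositional.Properties
  using (∈-++⁺ˡ; ∈-++⁺ʳ; ∈-++⁻; ∈-∃++; ∈-concat⁺; ∈-concat⁻; ∈-lookup)
open import Data.List.Relation.Binary.Disjoint.Propositional using (Disjoint)
open import Data.List.Relation.Unary.All as All using (All; []; _∷_)
import Data.List.Relation.Unary.All.Properties as All
open import Data.List.Relation.Unary.AllPairs using ([]; _∷_)
import Data.List.Relation.Unary.AllPairs.Properties as AllPairs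
open import Data.List.Relation.Unary.Any as Any using (Any; here; there)
import Data.List.Relation.Unary.Any.Properties as Any
open import Data.List.Relation.Unary.Unique.Propositional using (Unique)
import Data.List.Relation.Unary.Unique.Propositional.Properties as Unique
open import Data.Maybe using (Maybe; just; nothing)
import Data.Maybe.Properties as Maybe
open import Data.Product using (Σ; ∃; ∃₂; _×_; _,_; proj₁; proj₂)
open import Data.Sum using (_⊎_; inj₁; inj₂; [_,_]′)
open import Data.Unit using (⊤; tt)
open import Data.Empty using (⊥; ⊥-elim)
open import Function using (_∘_; id; _⇔_; mk⇔)
open import Function.Bundles using (module Equivalence)
open import Function.Construct.Composition using (_⇔-∘_)
open import Induction.WellFounded using (Acc; acc)
open import Relation.Nullary using (¬_; Dec; yes; no; contradiction)
open import Relation.Nullary.Decidable using (¬?; _×-dec_; decidable-stable)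
open import Relation.Binary.Definitions using (DecidableEquality)
open import Relation.Binary.Structures using (IsTotalOrder)
open import Relation.Unary using (Decidable)
open import Relation.Binary.PropositionalEquality

-- Linear algebra over a discrete field

module LinearAlgebra (R : RealField) where
  open RealField R
  open LinAlg R

  ring : CommutativeRing 0ℓ 0ℓ
  ring = record { isCommutativeRing = isCommutativeRing }

  module CommRing = CommutativeRing ring
  open CommRing
    using (*-comm; *-assoc; *-identityˡ; *-identityʳ; +-identityˡ; +-identityʳ;
           zeroˡ; zeroʳ; distribˡ; -‿inverseʳ)
  open RingProperties (CommutativeRing.ring ring) using (-‿distribˡ-*; -0#≈0#; -‿involutive)
  module S = Sums (CommutativeRing.semiring ring)
  open IsTotalOrder isTotalOrder using (total; antisym)
  open ≡-Reasoning

  -- Different tags refute x ≡ y, since then total x y and total y x would be the same term.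
  infix 4 _≟_
  _≟_ : DecidableEquality ℝ
  x ≟ y with total x y in xy | total y x in yx
  ... | inj₁ x≤y | inj₁ y≤x = yes (antisym x≤y y≤x)
  ... | inj₂ y≤x | inj₂ x≤y = yes (antisym x≤y y≤x)
  ... | inj₁ _   | inj₂ _   = no λ { refl → contradiction (trans (sym xy) yx) λ () }
  ... | inj₂ _   | inj₁ _   = no λ { refl → contradiction (trans (sym yx) xy) λ () }

  *-cancelʳ-0 : ∀ {x y} → y ≢ 0# → x * y ≡ 0# → x ≡ 0#
  *-cancelʳ-0 {x} {y} y≢0 xy≡0 with y⁻¹ , yy⁻¹≡1 ← inverse y y≢0 = begin
    x              ≡⟨ *-identityʳ x ⟨
    x * 1#         ≡⟨ cong (x *_) yy⁻¹≡1 ⟨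
    x * (y * y⁻¹)  ≡⟨ *-assoc x y y⁻¹ ⟨
    x * y * y⁻¹    ≡⟨ cong (_* y⁻¹) xy≡0 ⟩
    0# * y⁻¹       ≡⟨ zeroˡ y⁻¹ ⟩
    0#             ∎

  ∑≡sum : ∀ {m} (f : Fin m → ℝ) → ∑ f ≡ S.sum f
  ∑≡sum {zero}  f = refl
  ∑≡sum {suc m} f = cong (f zero +_) (∑≡sum (f ∘ suc))

  *-distribˡ-∑ : ∀ {m} c (f : Fin m → ℝ) → c * ∑ f ≡ ∑ (λ i → c * f i)
  *-distribˡ-∑ c f = begin
    c * ∑ f              ≡⟨ cong (c *_) (∑≡sum f) ⟩
    c * S.sum f          ≡⟨ S.*-distribˡ-sum c f ⟩
    S.sum (λ i → c * f i) ≡⟨ ∑≡sum (λ i → c * f i) ⟨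
    ∑ (λ i → c * f i)    ∎

  ∑-+ : ∀ {m} (f g : Fin m → ℝ) → ∑ (λ i → f i + g i) ≡ ∑ f + ∑ g
  ∑-+ f g = begin
    ∑ (λ i → f i + g i)     ≡⟨ ∑≡sum (λ i → f i + g i) ⟩
    S.sum (λ i → f i + g i) ≡⟨ S.∑-distrib-+ f g ⟩
    S.sum f + S.sum g       ≡⟨ cong₂ _+_ (∑≡sum f) (∑≡sum g) ⟨
    ∑ f + ∑ g               ∎

  ∑-cong : ∀ {m} {f g : Fin m → ℝ} → (∀ i → f i ≡ g i) → ∑ f ≡ ∑ g
  ∑-cong {zero}  f≗g = refl
  ∑-cong {suc m} f≗g = cong₂ _+_ (f≗g zero) (∑-cong (f≗g ∘ suc))

  ∑-zero : ∀ {m} {f : Fin m → ℝ} → (∀ i → f i ≡ 0#) → ∑ f ≡ 0#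
  ∑-zero {zero}  f≗0 = refl
  ∑-zero {suc m} f≗0 = trans (cong₂ _+_ (f≗0 zero) (∑-zero (f≗0 ∘ suc))) (+-identityˡ 0#)

  ∑-comm : ∀ {m n} (f : Fin m → Fin n → ℝ) → ∑ (λ i → ∑ (f i)) ≡ ∑ (λ j → ∑ (λ i → f i j))
  ∑-comm {m} {n} f = begin
    ∑ (λ i → ∑ (f i))                 ≡⟨ ∑-cong (λ i → ∑≡sum (f i)) ⟩
    ∑ (λ i → S.sum (f i))             ≡⟨ ∑≡sum (λ i → S.sum (f i)) ⟩
    S.sum (λ i → S.sum (f i))         ≡⟨ S.∑-comm f ⟩
    S.sum (λ j → S.sum (λ i → f i j)) ≡⟨ ∑≡sum (λ j → S.sum (λ i → f i j)) ⟨
    ∑ (λ j → S.sum (λ i → f i j))     ≡⟨ ∑-cong (λ j → ∑≡sum (λ i → f i j)) ⟨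
    ∑ (λ j → ∑ (λ i → f i j))         ∎

  ∑-single : ∀ {m} {f : Fin m → ℝ} i → (∀ j → j ≢ i → f j ≡ 0#) → ∑ f ≡ f i
  ∑-single zero    off = trans (cong (_ +_) (∑-zero λ j → off (suc j) λ ())) (+-identityʳ _)
  ∑-single (suc i) off =
    trans (cong₂ _+_ (off zero λ ()) (∑-single i λ j j≢i → off (suc j) (j≢i ∘ Fin.suc-injective)))
          (+-identityˡ _)

  -- If all the other terms were zero, the sum would equal `f i`. Applied to a row of A x = 0, this
  -- supplies a second vertex of the support of x.
  ∑-another-nonzero : ∀ {m} {f : Fin m → ℝ} → ∑ f ≡ 0# → ∀ i → f i ≢ 0# →
                      ∃ λ j → j ≢ i × f j ≢ 0#
  ∑-another-nonzero {f = f} ∑f≡0 i fi≢0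
    with any? (λ j → ¬? (j Fin.≟ i) ×-dec ¬? (f j ≟ 0#))
  ... | yes found = found
  ... | no  none  = contradiction (trans (sym (∑-single i off)) ∑f≡0) fi≢0
    where
    off : ∀ j → j ≢ i → f j ≡ 0#
    off j j≢i = decidable-stable (f j ≟ 0#) λ fj≢0 → none (j , j≢i , fj≢0)

  exchange : ∀ x y z → x * (y * z) ≡ y * (x * z)
  exchange x y z = trans (sym (*-assoc x y z)) (trans (cong (_* z) (*-comm x y)) (*-assoc y x z))

  -- Dot products and linear combinations

  infix 7 _·_
  _·_ : ∀ {n} → Vector n → Vector n → ℝ
  b · x = ∑ λ j → b j * x j

  combination : ∀ {k n} → (Fin k → ℝ) → (Fin k → Vector n) → Vector n
  combination c v j = ∑ λ i → c i * v i j

  ·-combination : ∀ {k n} (b : Vector n) (c : Fin k → ℝ) (v : Fin k → Vector n) →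
                  b · combination c v ≡ ∑ λ i → c i * (b · v i)
  ·-combination b c v = begin
    ∑ (λ j → b j * ∑ (λ i → c i * v i j))   ≡⟨ ∑-cong (λ j → *-distribˡ-∑ (b j) (λ i → c i * v i j)) ⟩
    ∑ (λ j → ∑ (λ i → b j * (c i * v i j))) ≡⟨ ∑-cong (λ j → ∑-cong (λ i → exchange (b j) (c i) (v i j))) ⟩
    ∑ (λ j → ∑ (λ i → c i * (b j * v i j))) ≡⟨ ∑-comm (λ j i → c i * (b j * v i j)) ⟩
    ∑ (λ i → ∑ (λ j → c i * (b j * v i j))) ≡⟨ ∑-cong (λ i → *-distribˡ-∑ (c i) (λ j → b j * v i j)) ⟨
    ∑ (λ i → c i * (b · v i))               ∎

  ·-linear : ∀ {n} (b x y : Vector n) c → b · (λ j → x j + c * y j) ≡ b · x + c * (b · y)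
  ·-linear b x y c = begin
    ∑ (λ j → b j * (x j + c * y j))
      ≡⟨ ∑-cong (λ j → trans (distribˡ _ _ _) (cong (b j * x j +_) (exchange (b j) c (y j)))) ⟩
    ∑ (λ j → b j * x j + c * (b j * y j))
      ≡⟨ ∑-+ (λ j → b j * x j) (λ j → c * (b j * y j)) ⟩
    b · x + ∑ (λ j → c * (b j * y j))
      ≡⟨ cong (b · x +_) (*-distribˡ-∑ c (λ j → b j * y j)) ⟨
    b · x + c * (b · y) ∎

  -- Solution spaces of homogeneous systems

  Solves : ∀ {r n} → (Fin r → Vector n) → Vector n → Set
  Solves B x = ∀ a → B a · x ≡ 0#

  -- A basis of the solution space dual to the coordinates in pivots.
  record SolutionBasis {r n} (B : Fin r → Vector n) : Set where
    field
      dim       : ℕ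
      pivots    : Fin dim → Fin n
      basis     : Fin dim → Vector n
      on-pivot  : ∀ i → basis i (pivots i) ≡ 1#
      off-pivot : ∀ i j → i ≢ j → basis i (pivots j) ≡ 0#
      solves    : ∀ i → Solves B (basis i)
      determined : ∀ x → Solves B x → (∀ i → x (pivots i) ≡ 0#) → ∀ j → x j ≡ 0#
      dim-bound : n ℕ.≤ r ℕ.+ dim

  x+[-x*y⁻¹]*y≡0 : ∀ x {y y⁻¹} → y * y⁻¹ ≡ 1# → x + (- (x * y⁻¹)) * y ≡ 0#
  x+[-x*y⁻¹]*y≡0 x {y} {y⁻¹} yy⁻¹≡1 = begin
    x + (- (x * y⁻¹)) * y  ≡⟨ cong (x +_) (-‿distribˡ-* _ _) ⟨
    x + - (x * y⁻¹ * y)    ≡⟨ cong (λ z → x + - z) (*-assoc _ _ _) ⟩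
    x + - (x * (y⁻¹ * y))  ≡⟨ cong (λ z → x + - (x * z)) (trans (*-comm _ _) yy⁻¹≡1) ⟩
    x + - (x * 1#)         ≡⟨ cong (λ z → x + - z) (*-identityʳ x) ⟩
    x + - x                ≡⟨ -‿inverseʳ x ⟩
    0#                     ∎

  0+c*0≡0 : ∀ {x y} c → x ≡ 0# → y ≡ 0# → x + c * y ≡ 0#
  0+c*0≡0 c refl refl = trans (+-identityˡ _) (zeroʳ c)

  -- If the new functional vanishes on the whole basis, nothing changes. Otherwise a basis vector on
  -- which it is nonzero clears it from the others and is dropped together with its pivot, so the
  -- dimension falls by one.
  add-equation : ∀ {r n} (B : Fin (suc r) → Vector n) → SolutionBasis (B ∘ suc) → SolutionBasis B
  add-equation {r} {n} B sb with any? (λ p → ¬? (B zero · SolutionBasis.basis sb p ≟ 0#))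
  ... | no none = record
    { SolutionBasis sb hiding (solves; determined; dim-bound)
    ; solves    = λ { i zero → decidable-stable (_ ≟ _) λ ≢0 → none (i , ≢0)
                    ; i (suc a) → solves i a }
    ; determined = λ x sol → determined x (sol ∘ suc)
    ; dim-bound = ℕ.m≤n⇒m≤1+n dim-bound
    }
    where open SolutionBasis sb
  ... | yes (p , φp≢0) = pivot sb p φp≢0
    where
    pivot : (sb : SolutionBasis (B ∘ suc)) → ∀ p → B zero · SolutionBasis.basis sb p ≢ 0# → SolutionBasis B
    pivot record { dim = suc d ; pivots = F ; basis = v ; on-pivot = on ; off-pivot = off
                 ; solves = sol ; determined = det ; dim-bound = bound } p φp≢0 = record
      { dim       = d
      ; pivots    = F ∘ punchIn p
      ; basis     = v′
      -- `v p` is zero at every remaining pivot, so adding multiples of it keeps the basis dual to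
      -- the pivots.
      ; on-pivot  = λ i → trans (cong₂ _+_ (on _) (trans (cong (ρ i *_) (off p _ (p≢ i))) (zeroʳ _))) (+-identityʳ 1#)
      ; off-pivot = λ i j i≢j → 0+c*0≡0 (ρ i) (off _ _ (i≢j ∘ punchIn-injective p i j)) (off p _ (p≢ j))
      ; solves    = sol′
      ; determined = det′
      ; dim-bound = subst (n ℕ.≤_) (ℕ.+-suc r d) bound
      }
      where
      φ : Vector n → ℝ
      φ = B zero ·_
      p≢ : ∀ i → p ≢ punchIn p i
      p≢ i = punchInᵢ≢i p i ∘ sym
      -- The coefficient that makes `φ` vanish on `v (punchIn p i) + ρ i * v p`.
      ρ : Fin d → ℝ
      ρ i = - (φ (v (punchIn p i)) * proj₁ (inverse (φ (v p)) φp≢0))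
      v′ : Fin d → Vector n
      v′ i j = v (punchIn p i) j + ρ i * v p j
      sol′ : ∀ i → Solves B (v′ i)
      sol′ i zero    = trans (·-linear (B zero) (v (punchIn p i)) (v p) (ρ i)) (x+[-x*y⁻¹]*y≡0 _ (proj₂ (inverse (φ (v p)) φp≢0)))
      sol′ i (suc a) = trans (·-linear (B (suc a)) (v (punchIn p i)) (v p) (ρ i)) (0+c*0≡0 (ρ i) (sol _ a) (sol p a))
      det′ : ∀ x → Solves B x → (∀ i → x (F (punchIn p i)) ≡ 0#) → ∀ j → x j ≡ 0#
      det′ x sx xF = det x (sx ∘ suc) xF-all
        where
        -- Subtracting `x (F p)` times `v p` gives a solution `y` of the old equations that is zero
        -- at all old pivots, so `y` is zero. Applying `φ` leaves `c * φ (v p) ≡ 0#`, hence `x` is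
        -- zero at the dropped pivot as well.
        c = - x (F p)
        y : Vector n
        y j = x j + c * v p j
        yF : ∀ i → y (F i) ≡ 0#
        yF i with p Fin.≟ i
        ... | yes refl = trans (cong (λ z → x (F p) + c * z) (on p))
                           (trans (cong (x (F p) +_) (*-identityʳ c)) (-‿inverseʳ _))
        ... | no  p≢i  = 0+c*0≡0 c (trans (cong (x ∘ F) (sym (punchIn-punchOut p≢i))) (xF _)) (off p i p≢i)
        y≡0 : ∀ j → y j ≡ 0#
        y≡0 = det y (λ a → trans (·-linear (B (suc a)) x (v p) c) (0+c*0≡0 c (sx (suc a)) (sol p a))) yF
        cφ≡0 : c * φ (v p) ≡ 0#
        cφ≡0 = begin
          c * φ (v p)        ≡⟨ +-identityˡ _ ⟨
          0# + c * φ (v p)   ≡⟨ cong (_+ c * φ (v p)) (sx zero) ⟨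
          φ x + c * φ (v p)  ≡⟨ ·-linear (B zero) x (v p) c ⟨
          φ y                ≡⟨ ∑-zero (λ j → trans (cong (B zero j *_) (y≡0 j)) (zeroʳ _)) ⟩
          0#                 ∎
        xFp : x (F p) ≡ 0#
        xFp = trans (sym (-‿involutive _)) (trans (cong -_ (*-cancelʳ-0 φp≢0 cφ≡0)) -0#≈0#)
        xF-all : ∀ i → x (F i) ≡ 0#
        xF-all i with p Fin.≟ i
        ... | yes refl = xFp
        ... | no  p≢i  = trans (cong (x ∘ F) (sym (punchIn-punchOut p≢i))) (xF _)

  δ : ∀ {n} → Fin n → Vector n
  δ i j with i Fin.≟ j
  ... | yes _ = 1#
  ... | no  _ = 0#

  δ-diag : ∀ {n} (i : Fin n) → δ i i ≡ 1#
  δ-diag i with i Fin.≟ i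
  ... | yes _   = refl
  ... | no  i≢i = contradiction refl i≢i

  δ-off : ∀ {n} {i j : Fin n} → i ≢ j → δ i j ≡ 0#
  δ-off {i = i} {j} i≢j with i Fin.≟ j
  ... | yes i≡j = contradiction i≡j i≢j
  ... | no  _   = refl

  solutionBasis : ∀ {r n} (B : Fin r → Vector n) → SolutionBasis B
  solutionBasis {zero}  B = record
    { pivots = id ; basis = δ ; on-pivot = δ-diag ; off-pivot = λ _ _ → δ-off
    ; solves = λ _ () ; determined = λ _ _ x≡0 → x≡0 ; dim-bound = ℕ.≤-refl }
  solutionBasis {suc r} B = add-equation B (solutionBasis (B ∘ suc))

  -- Evaluating a combination at a pivot isolates one coefficient. The injection `ι` selects a
  -- subfamily.
  basis-independent : ∀ {r n} {B : Fin r → Vector n} (sb : SolutionBasis B) {k}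
                      (ι : Fin k → Fin (SolutionBasis.dim sb)) → (∀ {i j} → ι i ≡ ι j → i ≡ j) →
                      LinIndep (SolutionBasis.basis sb ∘ ι)
  basis-independent sb ι ι-inj c comb≡0 i = begin
    c i                              ≡⟨ *-identityʳ _ ⟨
    c i * 1#                         ≡⟨ cong (c i *_) (on-pivot (ι i)) ⟨
    c i * basis (ι i) (pivots (ι i)) ≡⟨ ∑-single i (λ j j≢i → trans (cong (c j *_) (off-pivot _ _ (j≢i ∘ ι-inj))) (zeroʳ _)) ⟨
    ∑ (λ j → c j * basis (ι j) (pivots (ι i))) ≡⟨ comb≡0 (pivots (ι i)) ⟩
    0#                               ∎
    where open SolutionBasis sb

  -- If k > l, the l evaluations at `L` have a nonzero coefficient vector in their common kernel.
  -- Its combination vanishes on `L`, hence everywhere, against independence. The coefficient vector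
  -- is nonzero because it is 1 at its own pivot.
  independent-bound : ∀ {k l n} (v : Fin k → Vector n) → LinIndep v → (L : Fin l → Fin n) →
                      (∀ c → (∀ a → combination c v (L a) ≡ 0#) → ∀ j → combination c v j ≡ 0#) →
                      k ℕ.≤ l
  independent-bound {k} {l} v indep L separates = bound (solutionBasis λ a i → v i (L a))
    where
    bound : SolutionBasis (λ a i → v i (L a)) → k ℕ.≤ l
    bound record { dim = zero ; dim-bound = k≤ } = subst (k ℕ.≤_) (ℕ.+-identityʳ l) k≤
    bound record { dim = suc _ ; pivots = F ; basis = u ; on-pivot = on ; solves = sol } =
      contradiction (trans (sym c≡0) (on zero)) 0≢1
      where
      c = u zero
      c≡0 : c (F zero) ≡ 0#
      c≡0 = indep c (separates c λ a → trans (∑-cong λ i → *-comm (c i) _) (sol zero a)) (F zero)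

-- Rerouting a linkage

-- Well-founded induction on finite subsets: a step that gives no result removes a member, so some
-- step gives one.
descend : ∀ {n} {State : Subset n → Set} {Result : Set} →
          (∀ p → State p → Result ⊎ ∃ λ x → x ∈ₛ p × State (p - x)) →
          ∀ {p} → State p → Result
descend {n} {State} {Result} step = go (⊂-wellFounded _)
  where
  go : ∀ {p} → Acc _ p → State p → Result
  go {p} (acc rec) s with step p s
  ... | inj₁ r             = r
  ... | inj₂ (x , x∈p , s′) = go (rec (x∈p⇒p-x⊂p x∈p)) s′

-- Self-maps of a finite set

injective⇒surjective : ∀ {n} {f : Fin n → Fin n} → (∀ {i j} → f i ≡ f j → i ≡ j) →
                       ∀ y → ∃ λ x → f x ≡ y
injective⇒surjective {suc n} {f} f-inj y with any? (λ x → f x Fin.≟ y)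
... | yes found = found
... | no  none  = contradiction (injective⇒≤ {f = λ x → punchOut (y≢ x)} inj) ℕ.1+n≰n
  where
  y≢ : ∀ x → y ≢ f x
  y≢ x y≡fx = none (x , sym y≡fx)
  inj : ∀ {i j} → punchOut (y≢ i) ≡ punchOut (y≢ j) → i ≡ j
  inj = f-inj ∘ punchOut-injective (y≢ _) (y≢ _)

-- A choice of preimages is an injective self-map, hence surjective: every point is a chosen
-- preimage, and `f` recovers which point it was chosen for.
surjective⇒injective : ∀ {n} {f : Fin n → Fin n} → (∀ y → ∃ λ x → f x ≡ y) →
                       ∀ {i j} → f i ≡ f j → i ≡ j
surjective⇒injective {f = f} f-surj {i} {j} fi≡fj
  with injective⇒surjective g-inj i | injective⇒surjective g-inj j
  where
  g-inj : ∀ {x y} → proj₁ (f-surj x) ≡ proj₁ (f-surj y) → x ≡ y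
  g-inj {x} {y} gx≡gy = trans (sym (proj₂ (f-surj x))) (trans (cong f gx≡gy) (proj₂ (f-surj y)))
... | x , refl | y , refl =
  cong (proj₁ ∘ f-surj) (trans (sym (proj₂ (f-surj x))) (trans fi≡fj (proj₂ (f-surj y))))

-- Each point is either fixed or moved by `f`. A moved point carries a preimage under `f`, because
-- in the rerouting the values of `f` are the indices known to be stuck.
Choice : ∀ {t} → (Fin t → Fin t) → Fin t → Set
Choice f i = ⊤ ⊎ ∃ λ z → f z ≡ i

apply : ∀ {t} (f : Fin t → Fin t) {i} → Choice f i → Fin t
apply f {i} (inj₁ _) = i
apply f {i} (inj₂ _) = f i

record Rotation {t} (f : Fin t → Fin t) : Set where
  field
    choice     : ∀ i → Choice f i
    surjective : ∀ y → ∃ λ x → apply f (choice x) ≡ y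
    moves      : ∃₂ λ i e → choice i ≡ inj₂ e

-- Deleting points without preimage from the whole set leaves a nonempty set permuted by f.
rotation : ∀ {t} (f : Fin t → Fin t) → Fin t → Rotation f
rotation {t} f i₀ = descend step {full} ((λ _ → ∈⊤) , i₀ , ∈⊤)
  where
  State : Subset t → Set
  State p = (∀ {i} → i ∈ₛ p → f i ∈ₛ p) × Nonempty p

  rotate : ∀ p → Nonempty p → (∀ y → y ∈ₛ p → ∃ λ z → z ∈ₛ p × f z ≡ y) → Rotation f
  rotate p (i , i∈p) pre = record
    { choice = choice ; surjective = surj ; moves = moves (i ∈ₛ? p) }
    where
    choose : ∀ i → Dec (i ∈ₛ p) → Choice f i
    choose i (no _)    = inj₁ tt
    choose i (yes i∈p) = let z , _ , fz≡i = pre i i∈p in inj₂ (z , fz≡i)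
    choice : ∀ i → Choice f i
    choice i = choose i (i ∈ₛ? p)
    moves : (d : Dec (i ∈ₛ p)) → ∃₂ λ i e → choice i ≡ inj₂ e
    moves _ with i ∈ₛ? p in eq
    ... | no i∉p  = contradiction i∈p i∉p
    ... | yes _   = i , _ , cong (choose i) eq
    surj : ∀ y → ∃ λ x → apply f (choice x) ≡ y
    surj y with y ∈ₛ? p in eq
    ... | no _ = y , cong (apply f ∘ choose y) eq
    ... | yes y∈p with z , z∈p , fz≡y ← pre y y∈p = z , helper (z ∈ₛ? p)
      where
      helper : (d : Dec (z ∈ₛ p)) → apply f (choose z d) ≡ y
      helper (yes _)  = fz≡y
      helper (no z∉p) = contradiction z∈p z∉p

  step : ∀ p → State p → Rotation f ⊎ ∃ λ x → x ∈ₛ p × State (p - x)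
  step p (closed , i , i∈p)
    with any? (λ y → (y ∈ₛ? p) ×-dec ¬? (any? λ z → (z ∈ₛ? p) ×-dec (f z Fin.≟ y)))
  ... | no none = inj₁ (rotate p (i , i∈p) λ y y∈p →
          decidable-stable (any? λ z → (z ∈ₛ? p) ×-dec (f z Fin.≟ y)) λ nz → none (y , y∈p , nz))
  -- No point of `p` is sent to `y`, so `p` stays closed without it, and `f y` shows that what
  -- remains is nonempty.
  ... | yes (y , y∈p , isolated) = inj₂ (y , y∈p , (λ {j} j∈ → stays (mem j∈)) , f y , stays y∈p)
    where
    mem : ∀ {j} → j ∈ₛ p - y → j ∈ₛ p
    mem = p─q⊆p p _
    stays : ∀ {j} → j ∈ₛ p → f j ∈ₛ p - y
    stays {j} j∈p = x∈p∧x≢y⇒x∈p-y (closed j∈p) λ fj≡y → isolated (j , j∈p , fj≡y)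

-- Lists without repetition

module _ {A : Set} where

  head-++ : ∀ (a : List A) {c l l′} → head (a ++ c ∷ l) ≡ head (a ++ c ∷ l′)
  head-++ []      = refl
  head-++ (_ ∷ _) = refl

  last-++ : ∀ (a : List A) {c l} → last (a ++ c ∷ l) ≡ last (c ∷ l)
  last-++ []          = refl
  last-++ (_ ∷ [])    = refl
  last-++ (_ ∷ y ∷ a) = last-++ (y ∷ a)

  Unique-++⁻ : ∀ (a : List A) {b} → Unique (a ++ b) → Unique a × Unique b × Disjoint a b
  Unique-++⁻ []      u          = [] , u , λ ()
  Unique-++⁻ (x ∷ a) (x∉ ∷ u) with ua , ub , a#b ← Unique-++⁻ a u =
    All.++⁻ˡ a x∉ ∷ ua , ub , λ where
      (here refl , v∈b) → All.lookup (All.++⁻ʳ a x∉) v∈b refl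
      (there v∈a , v∈b) → a#b (v∈a , v∈b)

  Unique-concat⁻ : ∀ (ps : List (List A)) → Unique (concat ps) → ∀ i → Unique (lookup ps i)
  Unique-concat⁻ (p ∷ ps) u zero    = proj₁ (Unique-++⁻ p u)
  Unique-concat⁻ (p ∷ ps) u (suc i) = Unique-concat⁻ ps (proj₁ (proj₂ (Unique-++⁻ p u))) i

  ∈-lookup⇒∈-concat : ∀ (ps : List (List A)) i {v} → v ∈ lookup ps i → v ∈ concat ps
  ∈-lookup⇒∈-concat ps i v∈ = ∈-concat⁺ (lose (∈-lookup {xs = ps} i) v∈)

  Unique-concat⇒index≡ : ∀ (ps : List (List A)) → Unique (concat ps) →
                         ∀ {v} i j → v ∈ lookup ps i → v ∈ lookup ps j → i ≡ j
  Unique-concat⇒index≡ (p ∷ ps) u zero    zero    _  _  = refl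
  Unique-concat⇒index≡ (p ∷ ps) u zero    (suc j) v∈ w∈ =
    contradiction (v∈ , ∈-lookup⇒∈-concat ps j w∈) (proj₂ (proj₂ (Unique-++⁻ p u)))
  Unique-concat⇒index≡ (p ∷ ps) u (suc i) zero    v∈ w∈ =
    contradiction (w∈ , ∈-lookup⇒∈-concat ps i v∈) (proj₂ (proj₂ (Unique-++⁻ p u)))
  Unique-concat⇒index≡ (p ∷ ps) u (suc i) (suc j) v∈ w∈ =
    cong suc (Unique-concat⇒index≡ ps (proj₁ (proj₂ (Unique-++⁻ p u))) i j v∈ w∈)

-- Consecutive vertices of a list

module _ {n : ℕ} where

  Consec-∷⁻ : ∀ {u w x : Fin n} l → Consec u w (x ∷ l) → u ≡ x ⊎ Consec u w l
  Consec-∷⁻ (y ∷ l) (inj₁ (u≡x , _)) = inj₁ u≡x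
  Consec-∷⁻ (y ∷ l) (inj₂ c)         = inj₂ c

  Consec⇒∈ˡ : ∀ {u w : Fin n} l → Consec u w l → u ∈ l
  Consec⇒∈ˡ (x ∷ y ∷ l) (inj₁ (refl , _)) = here refl
  Consec⇒∈ˡ (x ∷ y ∷ l) (inj₂ c)          = there (Consec⇒∈ˡ (y ∷ l) c)

  Consec⇒∈-tail : ∀ {u w x : Fin n} l → Consec u w (x ∷ l) → w ∈ l
  Consec⇒∈-tail (y ∷ l) (inj₁ (_ , refl)) = here refl
  Consec⇒∈-tail (y ∷ l) (inj₂ c)          = there (Consec⇒∈-tail l c)

  Consec⇒∈ʳ : ∀ {u w : Fin n} l → Consec u w l → w ∈ l
  Consec⇒∈ʳ (x ∷ l) c = there (Consec⇒∈-tail l c)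

  Consec-++ : ∀ {u w : Fin n} a {l} → Consec u w l → Consec u w (a ++ l)
  Consec-++ []                    c = c
  Consec-++ (x ∷ [])    {_ ∷ _}   c = inj₂ c
  Consec-++ (x ∷ y ∷ a)           c = inj₂ (Consec-++ (y ∷ a) c)

  -- `c` occurs only once, and there it is followed by `s`. With the next lemma this shows that a
  -- rerouted edge at `c` is not an edge of the original path.
  successor-unique : ∀ {c w s : Fin n} a {b} → Unique (a ++ c ∷ s ∷ b) →
                     Consec c w (a ++ c ∷ s ∷ b) → w ≡ s
  successor-unique []      _         (inj₁ (_ , w≡s)) = w≡s
  successor-unique []      (c∉ ∷ _)  (inj₂ cw)        =
    contradiction refl (All.lookup c∉ (Consec⇒∈ˡ _ cw))
  successor-unique (x ∷ a) (x∉ ∷ u) cw with Consec-∷⁻ _ cw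
  ... | inj₁ refl = contradiction refl (All.lookup x∉ (∈-++⁺ʳ a (here refl)))
  ... | inj₂ cw′  = successor-unique a u cw′

  predecessor-∈ : ∀ {c w : Fin n} a {b} → Unique (a ++ c ∷ b) → Consec w c (a ++ c ∷ b) → w ∈ a
  predecessor-∈ []      (c∉ ∷ _) wc = contradiction refl (All.lookup c∉ (Consec⇒∈-tail _ wc))
  predecessor-∈ (x ∷ a) (_ ∷ u)  wc with Consec-∷⁻ _ wc
  ... | inj₁ refl = here refl
  ... | inj₂ wc′  = there (predecessor-∈ a u wc′)

-- Paths, routes and forests

module _ {n : ℕ} (G : Graph n) where

  IsPath-suffix : ∀ a {c l} → IsPath G (a ++ c ∷ l) → IsPath G (c ∷ l)
  IsPath-suffix []          p       = p
  IsPath-suffix (_ ∷ [])    (_ , p) = p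
  IsPath-suffix (_ ∷ y ∷ a) (_ , p) = IsPath-suffix (y ∷ a) p

  IsPath-splice : ∀ a {c l l′} → IsPath G (a ++ c ∷ l) → IsPath G (c ∷ l′) → IsPath G (a ++ c ∷ l′)
  IsPath-splice []          _       q = q
  IsPath-splice (_ ∷ [])    (e , _) q = e , q
  IsPath-splice (_ ∷ y ∷ a) (e , p) q = e , IsPath-splice (y ∷ a) p q

  -- Route τ w m: the vertex list m ++ τ ∷ [] is a walk from w to τ.
  data Route (τ : Fin n) : Fin n → List (Fin n) → Set where
    stop : Route τ τ []
    step : ∀ {w u m} → adj G w u ≡ true → Route τ u m → Route τ w (w ∷ m)

  Route⇒IsPath : ∀ {τ c w m e} → adj G c w ≡ true → Route τ w m → IsPath G (τ ∷ e) →
                 IsPath G (c ∷ m ++ τ ∷ e)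
  Route⇒IsPath cw stop        p = cw , p
  Route⇒IsPath cw (step wu r) p = cw , Route⇒IsPath wu r p

  Route⇒Consec : ∀ {τ c w m e} → Route τ w m → Consec c w (c ∷ m ++ τ ∷ e)
  Route⇒Consec stop       = inj₁ (refl , refl)
  Route⇒Consec (step _ _) = inj₁ (refl , refl)

  module _ (V T : Fin n → Set) where

    RootedAt : (Fin n → Maybe (Fin n)) → Fin n → Fin n → Set
    RootedAt root w τ = T τ × ∃ λ m → Route τ w m × Unique m × All (λ v → ¬ V v × root v ≡ just τ) m

    -- A forest outside V rooted at T: the value just τ at w means that w lies in the tree of
    -- τ, so two routes meeting outside V lead to the same root.
    record Forest : Set where
      field
        root  : Fin n → Maybe (Fin n)
        sound : ∀ {w τ} → root w ≡ just τ → RootedAt root w τ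
        base  : ∀ {v} → T v → root v ≡ just v

    Saturated : Forest → Set
    Saturated F = ∀ {w u τ} → ¬ V w → adj G w u ≡ true → root u ≡ just τ → root w ≢ nothing
      where open Forest F

    module _ (V? : Decidable V) (T? : Decidable T) where

      open Forest

      roots : Forest
      roots = record { root = λ v → r v (T? v) ; sound = λ {w} → s w (T? w) ; base = λ {v} → b v (T? v) }
        where
        r : ∀ v → Dec (T v) → Maybe (Fin n)
        r v (yes _) = just v
        r v (no _)  = nothing
        s : ∀ w {τ} (d : Dec (T w)) → r w d ≡ just τ → RootedAt (λ v → r v (T? v)) w τ
        s w (yes Tw) refl = Tw , [] , stop , [] , []
        b : ∀ v (d : Dec (T v)) → T v → r v d ≡ just v
        b v (yes _)  _  = refl
        b v (no ¬Tv) Tv = contradiction Tv ¬Tv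

      -- The route from `w` is `w` followed by the route from `u`. It stays free of repetitions
      -- because the latter has only labelled vertices and `w` had no label. Old labels are kept, so
      -- old routes remain valid.
      graft : (F : Forest) → ∀ {w u τ} → ¬ V w → adj G w u ≡ true →
              root F u ≡ just τ → root F w ≡ nothing → Forest
      graft F {w} {u} {τ} w∉V wu u↦τ w↦∅ = record
        { root = root′ ; sound = sound′ ; base = λ Tv → keep (base F Tv) }
        where
        root′ : Fin n → Maybe (Fin n)
        root′ v with v Fin.≟ w
        ... | yes _ = just τ
        ... | no  _ = root F v
        keep : ∀ {v σ} → root F v ≡ just σ → root′ v ≡ just σ
        keep {v} v↦σ with v Fin.≟ w
        ... | yes refl = contradiction (trans (sym w↦∅) v↦σ) λ ()
        ... | no  _    = v↦σ
        new : root′ w ≡ just τ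
        new with w Fin.≟ w
        ... | yes _  = refl
        ... | no w≢w = contradiction refl w≢w
        sound′ : ∀ {v σ} → root′ v ≡ just σ → RootedAt root′ v σ
        sound′ {v} v↦σ with v Fin.≟ w
        ... | no _ with Tσ , m , r , uniq , owned ← sound F v↦σ =
          Tσ , m , r , uniq , All.map (λ (v∉V , eq) → v∉V , keep eq) owned
        sound′ refl | yes refl with Tτ , m , r , uniq , owned ← sound F u↦τ =
          Tτ , w ∷ m , step wu r , All.map fresh owned ∷ uniq
             , (w∉V , new) ∷ All.map (λ (v∉V , eq) → v∉V , keep eq) owned
          where
          fresh : ∀ {v} → ¬ V v × root F v ≡ just τ → w ≢ v
          fresh (_ , v↦τ) refl = contradiction (trans (sym w↦∅) v↦τ) λ ()

      saturate : Σ Forest Saturated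
      saturate = descend step′ {full} (roots , λ _ → ∈⊤)
        where
        _≟ₘ_ = Maybe.≡-dec (Fin._≟_ {n})
        -- The subset bounds the unlabelled vertices; each graft labels one of them and so removes
        -- it.
        State : Subset n → Set
        State p = Σ Forest λ F → ∀ {v} → root F v ≡ nothing → v ∈ₛ p
        step′ : ∀ p → State p → Σ Forest Saturated ⊎ ∃ λ x → x ∈ₛ p × State (p - x)
        step′ p (F , rest)
          with any? (λ w → any? λ u → any? λ τ → ¬? (V? w) ×-dec (adj G w u Bool.≟ true)
                 ×-dec (root F u ≟ₘ just τ) ×-dec (root F w ≟ₘ nothing))
        ... | no none = inj₁ (F , λ w∉V wu u↦τ w↦∅ → none (_ , _ , _ , w∉V , wu , u↦τ , w↦∅))
        ... | yes (w , u , τ , w∉V , wu , u↦τ , w↦∅) =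
          inj₂ (w , rest w↦∅ , graft F w∉V wu u↦τ w↦∅ , rest′)
          where
          rest′ : ∀ {v} → root (graft F w∉V wu u↦τ w↦∅) v ≡ nothing → v ∈ₛ p - w
          rest′ {v} v↦∅ with v Fin.≟ w
          ... | no v≢w = x∈p∧x≢y⇒x∈p-y (rest v↦∅) v≢w

-- The rerouted linkage, with `X` abstracting the support of the null vector

module Rerouting {n : ℕ} (G : Graph n) (ps : List (List (Fin n))) (linkage : IsLinkage G ps)
  (X : Fin n → Set) (X? : Decidable X)
  (heads : ∀ i {h} → head (lookup ps i) ≡ just h → ¬ X h)
  (F : Forest G (VOf ps) (λ v → VOf ps v × X v))
  (exit : ∀ i {a c s b} → lookup ps i ≡ a ++ c ∷ s ∷ b → ¬ X c → X s →
          ∃₂ λ w τ → w ≢ s × X w × adj G c w ≡ true × Forest.root F w ≡ just τ)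
  where

  open Forest F

  t = length ps

  P : Fin t → List (Fin n)
  P = lookup ps

  P-path : ∀ i → IsPath G (P i)
  P-path i = All.lookup (proj₁ linkage) (∈-lookup {xs = ps} i)

  P-unique : ∀ i → Unique (P i)
  P-unique = Unique-concat⁻ ps (proj₂ linkage)

  index≡ : ∀ {v} i j → v ∈ P i → v ∈ P j → i ≡ j
  index≡ = Unique-concat⇒index≡ ps (proj₂ linkage)

  index : ∀ {v} → VOf ps v → ∃ λ i → v ∈ P i
  index v∈ = let v∈ps = ∈-concat⁻ ps v∈ in Any.index v∈ps , Any.lookup-index v∈ps

  -- The path is cut just before its first vertex in `X`. When there is such a vertex `s`, `shape`
  -- names the vertex `c` before it, which exists because paths start outside `X`.
  record Split (p : List (Fin n)) : Set where
    field
      pre suf : List (Fin n)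
      pre++suf : p ≡ pre ++ suf
      pre∉X    : ∀ {v} → v ∈ pre → ¬ X v
      shape    : suf ≡ [] ⊎ ∃₂ λ a c → ∃₂ λ s b → pre ≡ a ++ c ∷ [] × suf ≡ s ∷ b × X s

  split : ∀ h p → ¬ X h → Split (h ∷ p)
  split h [] h∉X = record
    { pre = h ∷ [] ; suf = [] ; pre++suf = refl
    ; pre∉X = λ { (here refl) → h∉X } ; shape = inj₁ refl }
  split h (s ∷ p) h∉X with X? s
  ... | yes s∈X = record
    { pre = h ∷ [] ; suf = s ∷ p ; pre++suf = refl
    ; pre∉X = λ { (here refl) → h∉X } ; shape = inj₂ ([] , h , s , p , refl , refl , s∈X) }
  ... | no s∉X = record
    { pre = h ∷ pre ; suf = suf ; pre++suf = cong (h ∷_) pre++suf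
    ; pre∉X = λ { (here refl) → h∉X ; (there v∈) → pre∉X v∈ }
    ; shape = [ inj₁ , (λ { (a , c , s , b , pre≡ , suf≡ , s∈X) →
                            inj₂ (h ∷ a , c , s , b , cong (h ∷_) pre≡ , suf≡ , s∈X) }) ]′ shape }
    where open Split (split s p s∉X)

  splitPath : ∀ i → Split (P i)
  splitPath i = go (P i) (P-path i) (heads i)
    where
    go : ∀ p → IsPath G p → (∀ {h} → head p ≡ just h → ¬ X h) → Split p
    go (h ∷ p) _ h∉X = split h p (h∉X refl)

  module Sp i = Split (splitPath i)
  open Sp using (pre; suf; pre++suf; pre∉X; shape)

  pre⊆P : ∀ i {v} → v ∈ pre i → v ∈ P i
  pre⊆P i v∈ = subst (_ ∈_) (sym (pre++suf i)) (∈-++⁺ˡ v∈)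

  suf⊆P : ∀ i {v} → v ∈ suf i → v ∈ P i
  suf⊆P i v∈ = subst (_ ∈_) (sym (pre++suf i)) (∈-++⁺ʳ (pre i) v∈)

  P⊆V : ∀ i {v} → v ∈ P i → VOf ps v
  P⊆V = ∈-lookup⇒∈-concat ps

  pre#suf : ∀ i k {v} → v ∈ pre i → v ∈ suf k → ⊥
  pre#suf i k v∈pre v∈suf with refl ← index≡ i k (pre⊆P i v∈pre) (suf⊆P k v∈suf) =
    proj₂ (proj₂ (Unique-++⁻ (pre i) (subst Unique (pre++suf i) (P-unique i)))) (v∈pre , v∈suf)

  -- The three sources of vertices for a strand from path `i` to path `k`: the prefix of `i`, the
  -- trees rooted in the suffix of `k`, and that suffix itself.
  data Owned (i k : Fin t) (v : Fin n) : Set where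
    before  : v ∈ pre i → Owned i k v
    between : ∀ {τ} → ¬ VOf ps v → root v ≡ just τ → τ ∈ suf k → Owned i k v
    after   : v ∈ suf k → Owned i k v

  -- Prefixes, suffixes and the vertices off the linkage are pairwise disjoint. A prefix vertex
  -- determines `i`; a suffix vertex determines `k`, and so does a tree vertex through its root.
  -- Strands that differ in both indices are therefore disjoint.
  owned-once : ∀ {i k i′ k′ v} → Owned i k v → Owned i′ k′ v → i ≡ i′ ⊎ k ≡ k′
  owned-once {i} {k} {i′} {k′} = go
    where
    go : ∀ {v} → Owned i k v → Owned i′ k′ v → i ≡ i′ ⊎ k ≡ k′
    go (before v∈)        (before v∈′)         = inj₁ (index≡ i i′ (pre⊆P i v∈) (pre⊆P i′ v∈′))
    go (before v∈)        (between v∉V _ _)    = contradiction (P⊆V i (pre⊆P i v∈)) v∉V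
    go (before v∈)        (after v∈′)          = ⊥-elim (pre#suf i k′ v∈ v∈′)
    go (between v∉V _ _)  (before v∈)          = contradiction (P⊆V i′ (pre⊆P i′ v∈)) v∉V
    go (between _ v↦τ τ∈) (between _ v↦τ′ τ∈′)
      with refl ← trans (sym v↦τ) v↦τ′         = inj₂ (index≡ k k′ (suf⊆P k τ∈) (suf⊆P k′ τ∈′))
    go (between v∉V _ _)  (after v∈)           = contradiction (P⊆V k′ (suf⊆P k′ v∈)) v∉V
    go (after v∈)         (before v∈′)         = ⊥-elim (pre#suf i′ k v∈′ v∈)
    go (after v∈)         (between v∉V _ _)    = contradiction (P⊆V k (suf⊆P k v∈)) v∉V
    go (after v∈)         (after v∈′)          = inj₂ (index≡ k k′ (suf⊆P k v∈) (suf⊆P k′ v∈′))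

  record Strand (i k : Fin t) : Set where
    field
      path   : List (Fin n)
      isPath : IsPath G path
      unique : Unique path
      head≡  : head path ≡ head (P i)
      last≡  : last path ≡ last (P k)
      owned  : ∀ {v} → v ∈ path → Owned i k v

  open Strand

  unchanged : ∀ i → Strand i i
  unchanged i = record
    { path = P i ; isPath = P-path i ; unique = P-unique i ; head≡ = refl ; last≡ = refl
    ; owned = λ v∈ → [ before , after ]′ (∈-++⁻ (pre i) (subst (_ ∈_) (pre++suf i) v∈)) }

  HasNewEdge : List (Fin n) → Set
  HasNewEdge p = ∃₂ λ u w → Consec u w p × ¬ EdgeOf ps u w

  Stuck : Fin t → Set
  Stuck i = Any X (P i)

  reroute : ∀ i → Stuck i → ∃ λ k → Stuck k × Σ (Strand i k) (HasNewEdge ∘ path)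
  reroute i stuck with shape i
  ... | inj₁ suf≡[] = contradiction stuck (All.All¬⇒¬Any (All.tabulate λ v∈ →
          pre∉X i (subst (_ ∈_) (trans (pre++suf i) (trans (cong (pre i ++_) suf≡[]) (++-identityʳ _))) v∈)))
  ... | inj₂ (a , c , s , b , pre≡ , suf≡ , s∈X)
    with Pi≡ ← trans (pre++suf i) (trans (cong₂ _++_ pre≡ suf≡) (++-assoc a (c ∷ []) (s ∷ b)))
    with w , τ , w≢s , w∈X , cw , w↦τ ← exit i Pi≡ (pre∉X i (subst (c ∈_) (sym pre≡) (∈-++⁺ʳ a (here refl)))) s∈X
    with (τ∈V , τ∈X) , m , r , m! , m-owned ← sound w↦τ
    with k , τ∈Pk ← index τ∈V
    with ∈-++⁻ (pre k) (subst (τ ∈_) (pre++suf k) τ∈Pk)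
  -- A root lies in `X` and prefixes avoid `X`, so `τ` is in the suffix of path `k`, which is thus
  -- stuck.
  ... | inj₁ τ∈pre = contradiction τ∈X (pre∉X k τ∈pre)
  ... | inj₂ τ∈suf
    with d , e , suf≡′ ← ∈-∃++ τ∈suf = k , lose τ∈Pk τ∈X , strand , c , w , consec , new
    where
    ac = a ++ c ∷ []

    Pk≡ : P k ≡ (pre k ++ d) ++ τ ∷ e
    Pk≡ = trans (pre++suf k) (trans (cong (pre k ++_) suf≡′) (sym (++-assoc (pre k) d (τ ∷ e))))

    consec : Consec c w (a ++ c ∷ m ++ τ ∷ e)
    consec = Consec-++ a (Route⇒Consec G r)

    -- `c` lies on path `i` alone. Its successor there is `s`, which differs from `w`, and a
    -- predecessor lies in the prefix, outside `X`, while `w` is in `X`.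
    new : ¬ EdgeOf ps c w
    new edge = [ (λ cw′ → w≢s (successor-unique a uniq (onPi (Consec⇒∈ˡ (P j) cw′) cw′)))
               , (λ wc → pre∉X i (subst (w ∈_) (sym pre≡) (∈-++⁺ˡ (predecessor-∈ a uniq (onPi (Consec⇒∈ʳ (P j) wc) wc)))) w∈X)
               ]′ (Any.lookup-index edge)
      where
      j = Any.index edge
      uniq : Unique (a ++ c ∷ s ∷ b)
      uniq = subst Unique Pi≡ (P-unique i)
      c∈Pi : c ∈ P i
      c∈Pi = subst (c ∈_) (sym Pi≡) (∈-++⁺ʳ a (here refl))
      onPi : ∀ {x y} → c ∈ P j → Consec x y (P j) → Consec x y (a ++ c ∷ s ∷ b)
      onPi {x} {y} c∈Pj xy = subst (Consec x y) (trans (cong P (index≡ j i c∈Pj c∈Pi)) Pi≡) xy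

    ac⊆ : ∀ {v} → v ∈ ac → v ∈ pre i
    ac⊆ = subst (_ ∈_) (sym pre≡)

    e⊆ : ∀ {v} → v ∈ τ ∷ e → v ∈ suf k
    e⊆ v∈ = subst (_ ∈_) (sym suf≡′) (∈-++⁺ʳ d v∈)

    ac! : Unique ac
    ac! = proj₁ (Unique-++⁻ ac (subst Unique (trans (pre++suf i) (cong (_++ suf i) pre≡)) (P-unique i)))

    e! : Unique (τ ∷ e)
    e! = proj₁ (proj₂ (Unique-++⁻ (pre k ++ d) (subst Unique Pk≡ (P-unique k))))

    m#e : Disjoint m (τ ∷ e)
    m#e (v∈m , v∈e) = proj₁ (All.lookup m-owned v∈m) (P⊆V k (suf⊆P k (e⊆ v∈e)))

    ac#me : Disjoint ac (m ++ τ ∷ e)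
    ac#me (v∈ac , v∈me) with ∈-++⁻ m v∈me
    ... | inj₁ v∈m = proj₁ (All.lookup m-owned v∈m) (P⊆V i (pre⊆P i (ac⊆ v∈ac)))
    ... | inj₂ v∈e = pre#suf i k (ac⊆ v∈ac) (e⊆ v∈e)

    assoc : ac ++ m ++ τ ∷ e ≡ a ++ c ∷ m ++ τ ∷ e
    assoc = ++-assoc a (c ∷ []) (m ++ τ ∷ e)

    owns : ∀ {v} → v ∈ a ++ c ∷ m ++ τ ∷ e → Owned i k v
    owns v∈ with ∈-++⁻ ac (subst (_ ∈_) (sym assoc) v∈)
    ... | inj₁ v∈ac = before (ac⊆ v∈ac)
    ... | inj₂ v∈me with ∈-++⁻ m v∈me
    ...   | inj₁ v∈m = let v∉V , v↦τ = All.lookup m-owned v∈m in between v∉V v↦τ τ∈suf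
    ...   | inj₂ v∈e = after (e⊆ v∈e)

    strand : Strand i k
    strand = record
      { path   = a ++ c ∷ m ++ τ ∷ e
      ; isPath = IsPath-splice G a (subst (IsPath G) Pi≡ (P-path i))
                   (Route⇒IsPath G cw r (IsPath-suffix G (pre k ++ d) (subst (IsPath G) Pk≡ (P-path k))))
      ; unique = subst Unique assoc (Unique.++⁺ ac! (Unique.++⁺ m! e! m#e) ac#me)
      ; head≡  = trans (head-++ a) (cong head (sym Pi≡))
      ; last≡  = trans (last-++ a) (trans (last-++ (c ∷ m)) (trans (sym (last-++ (pre k ++ d))) (cong last (sym Pk≡))))
      ; owned  = owns
      }

  NewStrand : Fin t → Fin t → Set
  NewStrand i k = Σ (Strand i k) (HasNewEdge ∘ path)

  module _ {i₀} (stuck₀ : Stuck i₀) where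

    -- Paths that are not stuck are sent to `i₀` by default. This makes the map total and keeps all
    -- its values stuck.
    target : ∀ i → ∃ λ k → Stuck k × (Stuck i → NewStrand i k)
    target i with Any.any? X? (P i)
    ... | yes stuck  = let k , stuckₖ , s = reroute i stuck in k , stuckₖ , λ _ → s
    ... | no  ¬stuck = i₀ , stuck₀ , λ stuck → contradiction stuck ¬stuck

    f : Fin t → Fin t
    f = proj₁ ∘ target

    newStrand : ∀ i → (∃ λ z → f z ≡ i) → NewStrand i (f i)
    newStrand i (z , fz≡i) = proj₂ (proj₂ (target i)) (subst Stuck fz≡i (proj₁ (proj₂ (target z))))

    strand : ∀ i (ch : Choice f i) → Strand i (apply f ch)
    strand i (inj₁ _) = unchanged i
    strand i (inj₂ e) = proj₁ (newStrand i e)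

    open Rotation (rotation f i₀)

    π : Fin t → Fin t
    π i = apply f (choice i)

    Q : ∀ i → Strand i (π i)
    Q i = strand i (choice i)

    qs : List (List (Fin n))
    qs = tabulate (path ∘ Q)

    qs-linkage : IsLinkage G qs
    qs-linkage = All.tabulate⁺ (isPath ∘ Q) ,
      Unique.concat⁺ (All.tabulate⁺ (unique ∘ Q)) (AllPairs.tabulate⁺ disjoint)
      where
      disjoint : ∀ {i j} → i ≢ j → Disjoint (path (Q i)) (path (Q j))
      disjoint {i} {j} i≢j (v∈i , v∈j) =
        -- Distinct strands have distinct sources, and distinct targets since `π` is a bijection.
        [ i≢j , i≢j ∘ surjective⇒injective surjective ]′ (owned-once (owned (Q i) v∈i) (owned (Q j) v∈j))

    qs-heads : ∀ {v} → Any (λ p → head p ≡ just v) ps ⇔ Any (λ p → head p ≡ just v) qs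
    qs-heads = mk⇔
      (λ h → Any.tabulate⁺ (Any.index h) (trans (head≡ (Q _)) (Any.lookup-index h)))
      (λ h → let i , eq = Any.tabulate⁻ h in lose (∈-lookup {xs = ps} i) (trans (sym (head≡ (Q i))) eq))

    qs-lasts : ∀ {v} → Any (λ p → last p ≡ just v) ps ⇔ Any (λ p → last p ≡ just v) qs
    qs-lasts = mk⇔
      -- The end of a path is the end of the strand that `π` sends to that path.
      (λ l → let i , πi≡ = surjective (Any.index l) in
             Any.tabulate⁺ i (trans (last≡ (Q i)) (trans (cong (last ∘ P) πi≡) (Any.lookup-index l))))
      (λ l → let i , eq = Any.tabulate⁻ l in lose (∈-lookup {xs = ps} (π i)) (trans (sym (last≡ (Q i))) eq))

    qs-newEdge : ∃₂ λ u w → EdgeOf qs u w × ¬ EdgeOf ps u w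
    qs-newEdge with i , e , choice≡ ← moves with u , w , uw , new ← proj₂ (newStrand i e) =
      u , w , Any.tabulate⁺ i (inj₁ (subst (λ ch → Consec u w (path (strand i ch))) (sym choice≡) uw)) , new

  not-rigid : ∀ {α β i} → Stuck i → ¬ IsRigid G α β ps
  not-rigid stuck ((_ , α⇔ , β⇔) , unique-linkage) =
    let u , w , uw , new = qs-newEdge stuck
        _ , same-edges = unique-linkage (qs stuck) (qs-linkage stuck
          , (λ v → qs-heads stuck ⇔-∘ α⇔ v) , (λ v → qs-lasts stuck ⇔-∘ β⇔ v))
    in new (Equivalence.to (same-edges u w) uw)

-- Null vectors

module Nullity (R : RealField) {n} (G : Graph n) (A : LinAlg.Matrix R n) (A∈S : LinAlg.InS R G A)
  (ps : List (List (Fin n))) where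
  open RealField R hiding (_≤_)
  open LinAlg R
  open LinearAlgebra R
  open CommRing using (zeroˡ; zeroʳ; *-identityˡ)

  V : Fin n → Set
  V = VOf ps

  V? : Decidable V
  V? v = _∈?_ Fin._≟_ v (concat ps)

  A-sym : ∀ i j → A i j ≡ A j i
  A-sym = proj₁ A∈S

  edge⇒≢0 : ∀ {i j} → i ≢ j → adj G i j ≡ true → A i j ≢ 0#
  edge⇒≢0 i≢j = proj₁ (proj₂ A∈S _ _ i≢j)

  ≢0⇒edge : ∀ {i j} → i ≢ j → A i j ≢ 0# → adj G i j ≡ true
  ≢0⇒edge {i} {j} i≢j Aij≢0 with adj G i j in ij
  ... | true  = refl
  ... | false = contradiction (proj₂ (proj₂ A∈S i j i≢j) ij) Aij≢0

  -- Null vectors of A(V), extended by zero, as solutions of a square system: each row in V is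
  -- replaced by a unit vector, which forces that coordinate to vanish.
  subSystem : Fin n → Vector n
  subSystem i with V? i
  ... | yes _ = δ i
  ... | no  _ = A i

  δ-· : ∀ i (x : Vector n) → δ i · x ≡ x i
  δ-· i x = trans (∑-single i λ j j≢i → trans (cong (_* x j) (δ-off (j≢i ∘ sym))) (zeroˡ _))
                  (trans (cong (_* x i) (δ-diag i)) (*-identityˡ _))

  NullVecSub⇒Solves : ∀ {x} → NullVecSub A V x → Solves subSystem x
  NullVecSub⇒Solves {x} (x-V , x-row) i with V? i
  ... | yes i∈V = trans (δ-· i x) (x-V i i∈V)
  ... | no  i∉V = x-row i i∉V

  Solves⇒NullVecSub : ∀ {x} → Solves subSystem x → NullVecSub A V x
  Solves⇒NullVecSub {x} sol = on-V , off-V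
    where
    on-V : ∀ i → V i → x i ≡ 0#
    on-V i i∈V with V? i | sol i
    ... | yes _   | eq = trans (sym (δ-· i x)) eq
    ... | no  i∉V | _  = contradiction i∈V i∉V
    off-V : ∀ i → ¬ V i → A i · x ≡ 0#
    off-V i i∉V with V? i | sol i
    ... | yes i∈V | _  = contradiction i∈V i∉V
    ... | no  _   | eq = eq

  subBasis : SolutionBasis subSystem
  subBasis = solutionBasis subSystem

  open SolutionBasis subBasis

  NullVec-combination : ∀ {k} (c : Fin k → ℝ) {v : Fin k → Vector n} →
                        (∀ i → NullVec A (v i)) → NullVec A (combination c v)
  NullVec-combination c {v} null i = trans (·-combination (A i) c v)
    (∑-zero λ j → trans (cong (c j *_) (null j i)) (zeroʳ _))

  -- Null vectors that vanish on the path heads and the pivots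

  module Vanishing (linkage : IsLinkage G ps) (x : Vector n) (x-null : NullVec A x)
    (x-heads : ∀ i {h} → head (lookup ps i) ≡ just h → x h ≡ 0#)
    (x-pivots : ∀ i → x (pivots i) ≡ 0#) where

    X : Fin n → Set
    X v = x v ≢ 0#

    X? : Decidable X
    X? v = ¬? (x v ≟ 0#)

    T? : Decidable (λ v → V v × X v)
    T? v = V? v ×-dec X? v

    ∉X : ∀ {v} → ¬ X v → x v ≡ 0#
    ∉X = decidable-stable (x _ ≟ 0#)

    forest : Forest G V (λ v → V v × X v)
    forest = proj₁ (saturate G V _ V? T?)

    saturated : Saturated G V _ forest
    saturated = proj₂ (saturate G V _ V? T?)

    open Forest forest

    -- x restricted to the vertices from which no route leads to V ∩ supp x: no row of A(V)
    -- mixes these with other coordinates of supp x.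
    y : Vector n
    y j with root j
    ... | just _  = 0#
    ... | nothing = x j

    unrooted∉V : ∀ {j} → V j → root j ≡ nothing → x j ≡ 0#
    unrooted∉V j∈V j↦∅ = ∉X λ j∈X → contradiction (trans (sym j↦∅) (base (j∈V , j∈X))) λ ()

    y-V : ∀ j → V j → y j ≡ 0#
    y-V j j∈V with root j in eq
    ... | just _  = refl
    ... | nothing = unrooted∉V j∈V eq

    no-edge : ∀ {i j τ} → ¬ V i → root i ≡ nothing → root j ≡ just τ → A i j ≡ 0#
    no-edge {i} {j} i∉V i↦∅ j↦τ = decidable-stable (A i j ≟ 0#) λ Aij≢0 →
      saturated i∉V (≢0⇒edge i≢j Aij≢0) j↦τ i↦∅
      where
      i≢j : i ≢ j
      i≢j refl = contradiction (trans (sym i↦∅) j↦τ) λ ()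

    -- An unrooted row has zero entries in rooted columns, so it gives the same sum on `y` as on
    -- `x`. In a rooted row every term is zero: `y` is zero in rooted columns, `x` is zero at
    -- unrooted vertices of V, and for the other columns the symmetry of `A` turns the entry into
    -- one of an unrooted row.
    y-row : ∀ i → ¬ V i → A i · y ≡ 0#
    y-row i i∉V with root i in i↦
    ... | nothing = trans (∑-cong same) (x-null i)
      where
      same : ∀ j → A i j * y j ≡ A i j * x j
      same j with root j in j↦
      ... | nothing = refl
      ... | just _  = trans (zeroʳ _) (sym (trans (cong (_* x j) (no-edge i∉V i↦ j↦)) (zeroˡ _)))
    ... | just _  = ∑-zero zero-term
      where
      zero-term : ∀ j → A i j * y j ≡ 0#
      zero-term j with root j in j↦
      ... | just _  = zeroʳ _
      ... | nothing with V? j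
      ...   | yes j∈V = trans (cong (A i j *_) (unrooted∉V j∈V j↦)) (zeroʳ _)
      ...   | no  j∉V = trans (cong (_* x j) (trans (A-sym i j) (no-edge j∉V j↦ i↦))) (zeroˡ _)

    y-pivots : ∀ i → y (pivots i) ≡ 0#
    y-pivots i with root (pivots i)
    ... | just _  = refl
    ... | nothing = x-pivots i

    -- `y` is a null vector of A(V) that is zero at the pivots, hence zero, and it agrees with `x`
    -- at unrooted vertices.
    unrooted⇒0 : ∀ {j} → root j ≡ nothing → x j ≡ 0#
    unrooted⇒0 {j} j↦∅ with root j | determined y (NullVecSub⇒Solves (y-V , y-row)) y-pivots j
    ... | nothing | yj≡0 = yj≡0
    unrooted⇒0 () | just _ | _

    -- In row `c` the term at `s` is nonzero, so another term, at some `w`, is nonzero too. Then `w`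
    -- is rooted, as `x` is zero at unrooted vertices, and `w` differs from `c` because `x c` is
    -- zero, so the entry at `w` comes from an edge.
    exit : ∀ i {a c s b} → lookup ps i ≡ a ++ c ∷ s ∷ b → ¬ X c → X s →
           ∃₂ λ w τ → w ≢ s × X w × adj G c w ≡ true × root w ≡ just τ
    exit i {a} {c} {s} eq c∉X s∈X = other (∑-another-nonzero (x-null c) s
      λ term≡0 → edge⇒≢0 c≢s cs (*-cancelʳ-0 s∈X term≡0))
      where
      c≢s : c ≢ s
      c≢s refl = c∉X s∈X
      cs : adj G c s ≡ true
      cs = proj₁ (IsPath-suffix G a (subst (IsPath G) eq (All.lookup (proj₁ linkage) (∈-lookup {xs = ps} i))))
      other : (∃ λ w → w ≢ s × A c w * x w ≢ 0#) →
              ∃₂ λ w τ → w ≢ s × X w × adj G c w ≡ true × root w ≡ just τ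
      other (w , w≢s , term≢0) with root w in w↦
      ... | just τ  = w , τ , w≢s , w∈X , ≢0⇒edge c≢w Acw≢0 , w↦
        where
        w∈X : X w
        w∈X xw≡0 = term≢0 (trans (cong (A c w *_) xw≡0) (zeroʳ _))
        c≢w : c ≢ w
        c≢w refl = c∉X w∈X
        Acw≢0 : A c w ≢ 0#
        Acw≢0 Acw≡0 = term≢0 (trans (cong (_* x w) Acw≡0) (zeroˡ _))
      ... | nothing = contradiction (trans (cong (A c w *_) (unrooted⇒0 w↦)) (zeroʳ _)) term≢0

    open Rerouting G ps linkage X X? (λ i h h∈X → h∈X (x-heads i h)) forest exit using (not-rigid)

    -- A vertex of V in the support would make its path stuck, against rigidity. So `x` is a null
    -- vector of A(V), and the pivots determine it.
    vanishes : ∀ {α β} → IsRigid G α β ps → ∀ j → x j ≡ 0#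
    vanishes rigid = determined x (NullVecSub⇒Solves (x-V , λ i _ → x-null i)) x-pivots
      where
      x-V : ∀ j → V j → x j ≡ 0#
      x-V j j∈V = ∉X λ j∈X → let j∈ps = ∈-concat⁻ ps j∈V in
        not-rigid {i = Any.index j∈ps} (lose (Any.lookup-index j∈ps) j∈X) rigid

  headOf : ∀ p → IsPath G p → ∃ λ h → head p ≡ just h
  headOf (h ∷ _) _ = h , refl

  nullity-bound : ∀ {α β} → IsRigid G α β ps → ∀ {k} (v : Fin k → Vector n) →
                  (∀ i → NullVec A (v i)) → LinIndep v → k ℕ.≤ length ps ℕ.+ dim
  nullity-bound rigid@((linkage , _) , _) v null indep = independent-bound v indep L λ c L≡0 →
    Vanishing.vanishes linkage (combination c v) (NullVec-combination c null)
      (λ i {h} eq → trans (cong (combination c v) (head≡ i eq)) (L≡0 (i ↑ˡ dim)))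
      (λ i → trans (cong (combination c v) (sym (cong [ heads , pivots ]′ (splitAt-↑ʳ (length ps) dim i)))) (L≡0 (length ps ↑ʳ i)))
      rigid
    where
    hd : ∀ i → ∃ λ h → head (lookup ps i) ≡ just h
    hd i = headOf (lookup ps i) (All.lookup (proj₁ linkage) (∈-lookup {xs = ps} i))
    heads : Fin (length ps) → Fin n
    heads = proj₁ ∘ hd
    -- The t path heads, which make up α, followed by the pivots of A(V).
    L : Fin (length ps ℕ.+ dim) → Fin n
    L = [ heads , pivots ]′ ∘ splitAt (length ps)
    head≡ : ∀ i {h} → head (lookup ps i) ≡ just h → h ≡ L (i ↑ˡ dim)
    head≡ i eq with refl ← trans (sym eq) (proj₂ (hd i)) =
      sym (cong [ heads , pivots ]′ (splitAt-↑ˡ (length ps) i dim))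

theorem3p4 : (R : RealField) → (n : ℕ) → (G : Graph n) → (α β : Fin n → Set) → (ps : List (List (Fin n))) → (t : ℕ) → IsRigid G α β ps → order ps ≡ t → (A : LinAlg.Matrix R n) → LinAlg.InS R G A → (k : ℕ) → LinAlg.NullityAtLeast R A k → LinAlg.SubNullityAtLeast R A (VOf ps) (k ∸ t)
theorem3p4 R n G α β ps t rigid refl A A∈S k (v , null , indep) =
  basis ∘ ι , (λ i → Solves⇒NullVecSub (solves (ι i))) ,
  basis-independent subBasis ι (inject≤-injective k∸t≤dim k∸t≤dim _ _)
  where
  open LinearAlgebra R
  open Nullity R G A A∈S ps
  open SolutionBasis subBasis
  -- Subtraction is truncated: for k below t an empty family is asked for.
  k∸t≤dim : k ∸ t ℕ.≤ dim
  k∸t≤dim = ℕ.m≤n+o⇒m∸n≤o k t (nullity-bound rigid v null indep)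
  ι : Fin (k ∸ t) → Fin dim
  ι i = inject≤ i k∸t≤dim
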